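{- For every constant $0<c<2$, there is a decision tree reduction of $\mathrm{polylog}(N)$ query complexity from $c$-$\textsc{Dual-AMGM-LC}$ to $\textsc{Lossy-Code}$.
   Context: Query model: inputs are functions between finite sets accessed by querying bits of the encodings of their values; a decision tree reduction computes each input bit of the target instance by a decision tree over the source input and maps each target solution back to a source solution by a decision tree; its complexity is log of the target input length plus maximum depth. $\textsc{Lossy-Code}$: given $f:[M]\to[2M]$, $g:[2M]\to[M]$, find $x\in[2M]$ with $f(g(x))\ne x$. $c$-$\textsc{Dual-AMGM-LC}$: let $V=[2N]$ and $H=[cN^2]$. The input is a coloring $C:V\to\{0,1\}$ and maps $F:H\to V\times V$, $G:V\times V\to H$. Let $P=\{(u,v)\in V\times V: C(u)=C(v)\}$. A solution is a pigeon $x\in P$ with $F(G(x))\neq x$.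
   Formalization: The constant c with 0 < c < 2 is taken to be rational rather than an arbitrary real number, with H of size ⌊cN²⌋. -}

module Defs where

open import Data.Nat using (ℕ; zero; suc; _+_; _*_; _^_; _≤_; _%_; _/_; _≡ᵇ_; _⊔_)
open import Data.Nat.Logarithm using (⌈log₂_⌉)
open import Data.Fin using (Fin; zero; suc; toℕ; combine)
open import Data.Vec using (Vec; _∷_; []; lookup)
open import Data.List using (List; map; allFin)
open import Data.Nat.ListAction using (sum)
open import Data.Bool using (Bool; true; false; if_then_else_)
open import Data.Product using (Σ; ∃; _×_; _,_)
open import Data.Integer using (+_; ∣_∣)
open import Data.Rational using (ℚ; floor)
import Data.Rational as ℚ
open import Relation.Binary.PropositionalEquality using (_≡_; _≢_)

bitAt : ℕ → ℕ → Bool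
bitAt n zero    = n % 2 ≡ᵇ 1
bitAt n (suc b) = bitAt (n / 2) b

bitsFor : ℕ → ℕ
bitsFor r = ⌈log₂ r ⌉

-- Problems in the query model.
-- An input is a finite tuple of functions ("blocks") between finite sets
-- F_k : [dom k] → [rng k]; it is accessed by querying bit b of the binary
-- encoding of F_k(a).

record QProblem : Set₁ where
  field
    blocks : ℕ
    dom    : Fin blocks → ℕ
    rng    : Fin blocks → ℕ
    Sol    : Set
    IsSol  : ((k : Fin blocks) → Fin (dom k) → Fin (rng k)) → Sol → Set

  Input : Set
  Input = (k : Fin blocks) → Fin (dom k) → Fin (rng k)

  Query : Set
  Query = Σ (Fin blocks) λ k → Fin (dom k) × Fin (bitsFor (rng k))

  answer : Input → Query → Bool
  answer x (k , a , b) = bitAt (toℕ (x k a)) (toℕ b)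

  inputLength : ℕ
  inputLength = sum (map (λ k → dom k * bitsFor (rng k)) (allFin blocks))

open QProblem public

data DT (Q : Set) (A : Set) : Set where
  leaf  : A → DT Q A
  query : Q → DT Q A → DT Q A → DT Q A   -- (query q) (if false) (if true)

evalDT : {Q A : Set} → DT Q A → (Q → Bool) → A
evalDT (leaf a)      ρ = a
evalDT (query q l r) ρ = if ρ q then evalDT r ρ else evalDT l ρ

depth : {Q A : Set} → DT Q A → ℕ
depth (leaf _)      = 0
depth (query _ l r) = suc (depth l ⊔ depth r)

record DTReduction (P T : QProblem) : Set where
  field
    bitTree : Query T → DT (Query P) Bool
    solTree : Sol T → DT (Query P) (Sol P)

  Computes : Input P → Input T → Set
  Computes x y = ∀ q → answer T y q ≡ evalDT (bitTree q) (answer P x)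

  field
    valid   : ∀ x → ∃ λ y → Computes x y
    correct : ∀ x y → Computes x y → ∀ s → IsSol T y s →
              IsSol P x (evalDT (solTree s) (answer P x))

open DTReduction public

ComplexityAtMost : {P T : QProblem} → DTReduction P T → ℕ → Set
ComplexityAtMost {P} {T} R B =
  ∃ λ d → (∀ q → depth (bitTree R q) ≤ d) × (∀ s → depth (solTree R s) ≤ d)
        × (⌈log₂ inputLength T ⌉ + d ≤ B)

LossyCode : ℕ → QProblem
LossyCode M = record
  { blocks = 2
  ; dom    = lookup (M ∷ 2 * M ∷ [])
  ; rng    = lookup (2 * M ∷ M ∷ [])
  ; Sol    = Fin (2 * M)
  ; IsSol  = λ y x → let f = y zero ; g = y (suc zero) in f (g x) ≢ x
  }

-- c-Dual-AMGM-LC with parameter N, V = [2N], H = [⌊c N²⌋].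
-- Blocks: C : V → [2]; F = (F₁ , F₂) : H → V × V (a pair is encoded by
-- concatenating the encodings of its components); G : V × V → H
-- (indexed by combine u v, i.e. the index u·2N + v).
-- A solution is (u , v) with C u = C v and F (G (u , v)) ≠ (u , v).

Hsize : ℚ → ℕ → ℕ
Hsize c N = ∣ floor (c ℚ.* (+ (N * N) ℚ./ 1)) ∣

DualAMGMLC : ℚ → ℕ → QProblem
DualAMGMLC c N = record
  { blocks = 4
  ; dom    = lookup (2 * N ∷ Hsize c N ∷ Hsize c N ∷ (2 * N) * (2 * N) ∷ [])
  ; rng    = lookup (2 ∷ 2 * N ∷ 2 * N ∷ Hsize c N ∷ [])
  ; Sol    = Fin (2 * N) × Fin (2 * N)
  ; IsSol  = λ x → λ { (u , v) →
      let C  = x zero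
          F₁ = x (suc zero)
          F₂ = x (suc (suc zero))
          G  = x (suc (suc (suc zero)))
          h  = G (combine u v)
      in (C u ≡ C v) × ((F₁ h , F₂ h) ≢ (u , v)) }
  }

{-# OPTIONS --safe #-}
module Submission where

-- A vector z , x₁ … x_m , y₁ … y_m of 2m + 1 vertices is compressed as follows.  By a discrete
-- intermediate value argument there is an i such that, after exchanging x_t and y_t for t ≤ i,
-- each colour occurs among the y's and z at least as often as among the x's.  Hence every x_t
-- can be paired with a y (or z) of the same colour, leaving one vertex r.  The code consists of
-- i, the colours of z and the y's, r, and the m values of G on the pairs.  The decoder recovers
-- the pairs by F and puts the y's back in place: the colour of x_t says in which colour class the
-- partner of x_t belongs, so the order of the G-values pays for the colours of the x's.  There are
-- 2N (m + 1) 2^(m+1) (c N²)^m codes against (2N)^(2m+1) vectors, so for c < 2 a constant m gives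
-- compression by a factor 2, and where decoding fails some pair (x , y) has F (G (x , y)) ≠ (x , y).

open import Defs
open import Data.Nat using (ℕ; zero; suc; _+_; _*_; _^_; _≤_; _%_; _≡ᵇ_; _≤?_; NonZero; ⌊_/2⌋; ⌈_/2⌉; z≤n; s≤s; ≢-nonZero; >-nonZero; >-nonZero⁻¹)
import Data.Nat as ℕ
open import Data.Nat.DivMod using (_mod_; m≡m%n+[m/n]*n; m<n⇒m%n≡m; m%n<n; m<n*o⇒m/o<n; m/n*n≤m)
open import Data.Nat.Logarithm using (⌈log₂_⌉; ⌈log₂⌉-mono-≤; ⌈log₂2^n⌉≡n; ⌈log₂⌈n/2⌉⌉≡⌈log₂n⌉∸1; ⌈log₂2*n⌉≡1+⌈log₂n⌉)
open import Data.Nat.Properties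
open import Data.Nat.Tactic.RingSolver using (solve-∀)
open import Data.Integer using (+_; -[1+_]; ∣_∣)
import Data.Integer as ℤ
import Data.Integer.Properties as ℤ
open import Data.Rational using (ℚ; mkℚ; 0ℚ; _<_; _/_; floor; ↥_; ↧ₙ_)
import Data.Rational as ℚ
import Data.Rational.Properties as ℚ
open import Data.Rational.Unnormalised using (mkℚᵘ; *≡*)
import Data.Rational.Unnormalised as ℚᵘ
import Data.Rational.Unnormalised.Properties as ℚᵘ
open import Data.Bool using (Bool; true; false; if_then_else_)
open import Data.Empty using (⊥-elim)
open import Data.Fin using (Fin; zero; suc; toℕ; combine; inject≤; funToFin; finToFun)
open import Data.Fin.Patterns using (0F; 1F)
open import Data.Fin.Properties using (toℕ-injective; toℕ-fromℕ<; toℕ<n; toℕ-inject≤; *↔×; finToFun-funToFin; funToFin-finToFin)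
import Data.Fin.Properties as Fin
open import Data.Product using (Σ; ∃; ∃-syntax; _×_; _,_; proj₁; proj₂)
import Data.Product as Prod
open import Data.Product.Function.NonDependent.Propositional using (_×-↔_)
open import Data.Product.Properties using (≡-dec)
open import Data.Sum using (inj₁; inj₂)
open import Data.Vec using (Vec; []; _∷_; map; head; tail; lookup; tabulate; insertAt; removeAt)
open import Data.Vec.Properties using (insertAt-removeAt; lookup-map; map-∘; map-id; tabulate-cong; tabulate∘lookup; lookup∘tabulate)
open import Data.Vec.Relation.Unary.All using (All; []; _∷_)
open import Function.Bundles using (_↔_; mk↔ₛ′; module Inverse)
open import Function.Construct.Composition using (_↔-∘_)
open import Function.Construct.Identity using (↔-id)
open import Function.Construct.Symmetry using (↔-sym)
open import Relation.Binary.Definitions using (DecidableEquality)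
open import Relation.Binary.PropositionalEquality
open import Relation.Nullary using (¬_; yes; no; does; contradiction)

-- Balancing and pairing coloured vectors

Colour : Set
Colour = Fin 2

indicator : Colour → Colour → ℕ
indicator γ c = if does (γ Fin.≟ c) then 1 else 0

count : ∀ {n} → Colour → Vec Colour n → ℕ
count γ []       = 0
count γ (c ∷ cs) = indicator γ c + count γ cs

indicator-≤1 : ∀ γ c → indicator γ c ≤ 1
indicator-≤1 γ c with γ Fin.≟ c
... | yes _ = s≤s z≤n
... | no  _ = z≤n

indicator-refl : ∀ γ → indicator γ γ ≡ 1
indicator-refl 0F = refl
indicator-refl 1F = refl

indicator-0+1 : ∀ c → indicator 0F c + indicator 1F c ≡ 1
indicator-0+1 0F = refl
indicator-0+1 1F = refl

count-0+1 : ∀ {n} (cs : Vec Colour n) → count 0F cs + count 1F cs ≡ n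
count-0+1 []       = refl
count-0+1 (c ∷ cs) = trans (interchange (indicator 0F c) _ (indicator 1F c) _)
                           (cong₂ _+_ (indicator-0+1 c) (count-0+1 cs))
  where
  interchange : ∀ a b c d → (a + b) + (c + d) ≡ (a + c) + (b + d)
  interchange = solve-∀

count-removeAt : ∀ {n} γ (cs : Vec Colour (suc n)) i →
                 indicator γ (lookup cs i) + count γ (removeAt cs i) ≡ count γ cs
count-removeAt γ (c ∷ cs)         zero    = refl
count-removeAt γ (c ∷ cs@(_ ∷ _)) (suc i) =
  trans (swap-front (indicator γ (lookup cs i)) (indicator γ c) _)
        (cong (_+_ (indicator γ c)) (count-removeAt γ cs i))
  where
  swap-front : ∀ a b c → a + (b + c) ≡ b + (a + c)
  swap-front = solve-∀

map-removeAt : ∀ {A B : Set} {n} (f : A → B) (xs : Vec A (suc n)) i →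
               map f (removeAt xs i) ≡ removeAt (map f xs) i
map-removeAt f (x ∷ xs)         zero    = refl
map-removeAt f (x ∷ xs@(_ ∷ _)) (suc i) = cong (f x ∷_) (map-removeAt f xs i)

-- Junk value: the last index when the colour does not occur.
firstIndex : ∀ {n} → Colour → Vec Colour (suc n) → Fin (suc n)
firstIndex γ (c ∷ [])         = zero
firstIndex γ (c ∷ cs@(_ ∷ _)) = if does (γ Fin.≟ c) then zero else suc (firstIndex γ cs)

lookup-firstIndex : ∀ {n} γ (cs : Vec Colour (suc n)) → 1 ≤ count γ cs →
                    lookup cs (firstIndex γ cs) ≡ γ
lookup-firstIndex γ (c ∷ []) 1≤ with γ Fin.≟ c
... | yes γ≡c = sym γ≡c
... | no  _   = contradiction 1≤ λ ()
lookup-firstIndex γ (c ∷ cs@(_ ∷ _)) 1≤ with γ Fin.≟ c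
... | yes γ≡c = sym γ≡c
... | no  _   = lookup-firstIndex γ cs 1≤

module _ {A : Set} (colour : A → Colour) where

  partnerIndex : ∀ {n} → A → Vec A (suc n) → Fin (suc n)
  partnerIndex x ys = firstIndex (colour x) (map colour ys)

  pairUp : ∀ {n} → Vec A n → Vec A (suc n) → Vec (A × A) n × A
  pairUp []       (r ∷ []) = [] , r
  pairUp (x ∷ xs) ys       =
    let i = partnerIndex x ys
        ps , r = pairUp xs (removeAt ys i)
    in (x , lookup ys i) ∷ ps , r

  -- Replays the greedy choices of `pairUp` from colours alone: the colour of `x` and the colours of
  -- the slots still open determine the slot that its partner came from.
  unpair : ∀ {n} → Vec (A × A) n → A → Vec Colour (suc n) → Vec A (suc n)
  unpair []             r cs = r ∷ []
  unpair ((x , y) ∷ ps) r cs =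
    let i = firstIndex (colour x) cs
    in insertAt (unpair ps r (removeAt cs i)) i y

  pairUp-fst : ∀ {n} (xs : Vec A n) ys → map proj₁ (proj₁ (pairUp xs ys)) ≡ xs
  pairUp-fst []       (r ∷ []) = refl
  pairUp-fst (x ∷ xs) ys       = cong (x ∷_) (pairUp-fst xs _)

  -- Both directions compute the slot by the same `firstIndex`, so they agree even where it returns
  -- its junk value. Removing an entry commutes with taking colours, which keeps the two recursions
  -- in step.
  unpair-pairUp : ∀ {n} (xs : Vec A n) ys →
                  let ps , r = pairUp xs ys in unpair ps r (map colour ys) ≡ ys
  unpair-pairUp []       (r ∷ []) = refl
  unpair-pairUp (x ∷ xs) ys
    rewrite sym (map-removeAt colour ys (partnerIndex x ys))
          | unpair-pairUp xs (removeAt ys (partnerIndex x ys))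
    = insertAt-removeAt ys _

  Monochromatic : A × A → Set
  Monochromatic (x , y) = colour x ≡ colour y

  -- The domination of colour counts is an invariant of the greedy pairing. Since the colour of `x`
  -- occurs on the left, it occurs on the right too, so a partner of that colour is found; removing
  -- both lowers the two counts of that colour by one each.
  pairUp-monochromatic : ∀ {n} (xs : Vec A n) ys →
    (∀ γ → count γ (map colour xs) ≤ count γ (map colour ys)) →
    All Monochromatic (proj₁ (pairUp xs ys))
  pairUp-monochromatic []       (r ∷ []) _  = []
  pairUp-monochromatic (x ∷ xs) ys       le =
    sym same ∷ pairUp-monochromatic xs (removeAt ys i) le′
    where
    i = partnerIndex x ys
    i-colour : lookup (map colour ys) i ≡ colour x
    i-colour = lookup-firstIndex (colour x) (map colour ys)
      (≤-trans (≤-trans (≤-reflexive (sym (indicator-refl (colour x)))) (m≤m+n _ _)) (le (colour x)))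
    same : colour (lookup ys i) ≡ colour x
    same = trans (sym (lookup-map i colour ys)) i-colour
    le′ : ∀ γ → count γ (map colour xs) ≤ count γ (map colour (removeAt ys i))
    le′ γ = +-cancelˡ-≤ (indicator γ (colour x)) _ _ (begin
      indicator γ (colour x) + count γ (map colour xs)                 ≤⟨ le γ ⟩
      count γ (map colour ys)                                          ≡⟨ count-removeAt γ (map colour ys) i ⟨
      indicator γ (lookup (map colour ys) i) + count γ (removeAt (map colour ys) i)
        ≡⟨ cong₂ (λ c cs → indicator γ c + count γ cs) i-colour (sym (map-removeAt colour ys i)) ⟩
      indicator γ (colour x) + count γ (map colour (removeAt ys i))    ∎)
      where open ≤-Reasoning

-- The first i entries are taken from the second vector, so that
-- (mix i xs ys , mix i ys xs) exchanges the first i pairs.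
mix : ∀ {A : Set} {m} → Fin (suc m) → Vec A m → Vec A m → Vec A m
mix zero    xs       ys       = xs
mix (suc i) (x ∷ xs) (y ∷ ys) = y ∷ mix i xs ys

mix-involutive : ∀ {A : Set} {m} i (xs ys : Vec A m) → mix i (mix i xs ys) (mix i ys xs) ≡ xs
mix-involutive zero    xs       ys       = refl
mix-involutive (suc i) (x ∷ xs) (y ∷ ys) = cong (x ∷_) (mix-involutive i xs ys)

map-mix : ∀ {A B : Set} {m} (f : A → B) i (xs ys : Vec A m) →
          map f (mix i xs ys) ≡ mix i (map f xs) (map f ys)
map-mix f zero    xs       ys       = refl
map-mix f (suc i) (x ∷ xs) (y ∷ ys) = cong (f y ∷_) (map-mix f i xs ys)

Balanced : ∀ {m} → Colour → Vec Colour m → Vec Colour m → Fin (suc m) → Set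
Balanced z xs ys i = ∀ γ → count γ (mix i xs ys) ≤ count γ (z ∷ mix i ys xs)

ones : ∀ {n} → Vec Colour n → ℕ
ones = count 1F

pull-1 : ∀ a b c → a + 1 + b + c ≡ suc (a + (b + c))
pull-1 = solve-∀

-- Discrete intermediate value theorem: exchanging one more pair changes the difference
-- (b + ones of the right) − (a + ones of the left) by at most 2, so on its way
-- from ≥ 0 to ≤ 1 it takes the value 0 or 1.
crossing : ∀ {m} (xs ys : Vec Colour m) a b →
           a + ones xs ≤ b + ones ys → b + ones xs ≤ suc (a + ones ys) →
           ∃[ i ] a + ones (mix i xs ys) ≤ b + ones (mix i ys xs)
                × b + ones (mix i ys xs) ≤ suc (a + ones (mix i xs ys))
crossing xs ys a b start end with b + ones ys ≤? suc (a + ones xs)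
crossing xs ys a b start end             | yes done = zero , start , done
-- With no pair left to exchange, `end` is the very inequality that was refuted.
crossing [] [] a b start end             | no ¬done = contradiction end ¬done
crossing (x ∷ xs) (y ∷ ys) a b start end | no ¬done =
  -- The accumulators hold the ones of the exchanged prefix, so `y` is charged to the left side `a`
  -- and `x` to the right side `b`.
  let i , lo , hi = crossing xs ys (a + indicator 1F y) (b + indicator 1F x) start′ end′
  in suc i
   , subst₂ _≤_ (+-assoc a _ _) (+-assoc b _ _) lo
   , subst₂ _≤_ (+-assoc b _ _) (cong suc (+-assoc a _ _)) hi
  where
  X = ones xs
  Y = ones ys
  dx = indicator 1F x
  dy = indicator 1F y
  open ≤-Reasoning
  start′ : a + dy + X ≤ b + dx + Y
  start′ = ≤-pred (begin
    suc (a + dy + X)          ≤⟨ s≤s (+-monoˡ-≤ X (+-monoʳ-≤ a (indicator-≤1 1F y))) ⟩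
    suc (a + 1 + X)           ≤⟨ s≤s (+-monoˡ-≤ X (m≤m+n (a + 1) dx)) ⟩
    suc (a + 1 + dx + X)      ≡⟨ cong suc (pull-1 a dx X) ⟩
    suc (suc (a + (dx + X)))  ≤⟨ ≰⇒> ¬done ⟩
    b + (dy + Y)              ≤⟨ +-monoʳ-≤ b (+-monoˡ-≤ Y (indicator-≤1 1F y)) ⟩
    b + (1 + Y)               ≡⟨ +-suc b Y ⟩
    suc (b + Y)               ≤⟨ s≤s (+-monoˡ-≤ Y (m≤m+n b dx)) ⟩
    suc (b + dx + Y)          ∎)
  end′ : b + dx + X ≤ suc (a + dy + Y)
  end′ = subst₂ _≤_ (sym (+-assoc b _ _)) (cong suc (sym (+-assoc a _ _))) end

-- The right side has one entry more than the left, so the differences (right minus left) in the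
-- counts of the two colours add up to 1. Both are nonnegative exactly when the difference in ones
-- is 0 or 1, which `crossing` achieves.
balanced-exists : ∀ {m} z (xs ys : Vec Colour m) → ∃ (Balanced z xs ys)
balanced-exists {m} z xs ys = finish balancedOnes
  where
  dz = indicator 1F z
  open ≤-Reasoning
  balancedOnes : ∃[ i ] ones (mix i xs ys) ≤ ones (z ∷ mix i ys xs)
                      × ones (z ∷ mix i ys xs) ≤ suc (ones (mix i xs ys))
  balancedOnes with ≤-total (ones xs) (ones ys)
  ... | inj₁ xs≤ys = crossing xs ys 0 dz (≤-trans xs≤ys (m≤n+m _ dz))
                       (+-mono-≤ (indicator-≤1 1F z) xs≤ys)
  -- If `ys` has fewer ones, the sides are swapped and the constants become `dz` and 1. The quantity
  -- followed is then 1 minus the former difference, which lies in {0, 1} at the same indices.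
  ... | inj₂ ys≤xs
    with i , lo , hi ← crossing ys xs dz 1 (+-mono-≤ (indicator-≤1 1F z) ys≤xs)
                         (s≤s (≤-trans ys≤xs (m≤n+m _ dz)))
    = i , ≤-pred hi , lo
  finish : ∃[ i ] ones (mix i xs ys) ≤ ones (z ∷ mix i ys xs)
                × ones (z ∷ mix i ys xs) ≤ suc (ones (mix i xs ys)) →
           ∃ (Balanced z xs ys)
  finish (i , lo , hi) = i , λ { 0F → zeros ; 1F → lo }
    where
    us = mix i xs ys
    vs = z ∷ mix i ys xs
    zeros : count 0F us ≤ count 0F vs
    zeros = +-cancelʳ-≤ (ones vs) _ _ (begin
      count 0F us + ones vs          ≤⟨ +-monoʳ-≤ (count 0F us) hi ⟩
      count 0F us + suc (ones us)    ≡⟨ +-suc _ _ ⟩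
      suc (count 0F us + ones us)    ≡⟨ cong suc (count-0+1 us) ⟩
      suc m                          ≡⟨ count-0+1 vs ⟨
      count 0F vs + ones vs          ∎)

balancingIndex : ∀ {m} → Colour → Vec Colour m → Vec Colour m → Fin (suc m)
balancingIndex z xs ys = proj₁ (balanced-exists z xs ys)

balancingIndex-balanced : ∀ {m} z (xs ys : Vec Colour m) → Balanced z xs ys (balancingIndex z xs ys)
balancingIndex-balanced z xs ys = proj₂ (balanced-exists z xs ys)

-- Plans: reversible records of triples

pairUp-map : ∀ {A B : Set} {n} (f : A → B) (colour : B → Colour) (xs : Vec A n) ys →
             pairUp colour (map f xs) (map f ys) ≡
             (let ps , r = pairUp (λ a → colour (f a)) xs ys in map (Prod.map f f) ps , f r)
pairUp-map f colour []       (r ∷ []) = refl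
pairUp-map f colour (x ∷ xs) ys
  rewrite sym (map-∘ colour f ys)
        | sym (map-removeAt f ys (partnerIndex (λ a → colour (f a)) x ys))
        | lookup-map (partnerIndex (λ a → colour (f a)) x ys) f ys
        | pairUp-map f colour xs (removeAt ys (partnerIndex (λ a → colour (f a)) x ys))
  = refl

-- The entries stand for the exchange index, the colours of `z` and the mixed `ys`, the pairs, and
-- the unpaired vertex. `B` is left open because a pair is stored either as itself or as its image
-- under `G`.
Plan : ℕ → Set → Set → Set
Plan m A B = Fin (suc m) × Vec Colour (suc m) × Vec B m × A

Triple : ℕ → Set → Set
Triple m A = A × Vec A m × Vec A m

mapTriple : ∀ {A B : Set} {m} → (A → B) → Triple m A → Triple m B
mapTriple f (z , xs , ys) = f z , map f xs , map f ys

module _ {A : Set} (colour : A → Colour) where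

  plan : ∀ {m} → Triple m A → Plan m A (A × A)
  plan (z , xs , ys) =
    let i = balancingIndex (colour z) (map colour xs) (map colour ys)
        vs = z ∷ mix i ys xs
        ps , r = pairUp colour (mix i xs ys) vs
    in i , map colour vs , ps , r

  assemble : ∀ {m} → Plan m A (A × A) → Triple m A
  assemble (i , cs , ps , r) =
    let us = map proj₁ ps
        vs = unpair colour ps r cs
    in head vs , mix i us (tail vs) , mix i (tail vs) us

  assemble-plan : ∀ {m} (t : Triple m A) → assemble (plan t) ≡ t
  assemble-plan (z , xs , ys)
    -- From here `i` is arbitrary: exchanging the same prefix twice restores both vectors.
    with i ← balancingIndex (colour z) (map colour xs) (map colour ys)
    rewrite unpair-pairUp colour (mix i xs ys) (z ∷ mix i ys xs)
          | pairUp-fst colour (mix i xs ys) (z ∷ mix i ys xs)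
    = cong₂ (λ as bs → z , as , bs) (mix-involutive i xs ys) (mix-involutive i ys xs)

  plan-monochromatic : ∀ {m} (t : Triple m A) →
                       All (Monochromatic colour) (proj₁ (proj₂ (proj₂ (plan t))))
  plan-monochromatic (z , xs , ys) = pairUp-monochromatic colour (mix i xs ys) (z ∷ mix i ys xs) λ γ →
    subst₂ _≤_ (cong (count γ) (sym (map-mix colour i xs ys)))
               (cong (λ cs → count γ (colour z ∷ cs)) (sym (map-mix colour i ys xs)))
               (balancingIndex-balanced (colour z) (map colour xs) (map colour ys) γ)
    where i = balancingIndex (colour z) (map colour xs) (map colour ys)

-- All choices in a plan depend on colours only, so a plan commutes with relabelling. With `f`
-- attaching its colour to each vertex, this lets a tree compute the plan from the colours it has
-- read.
plan-map : ∀ {A B : Set} {m} (f : A → B) (colour : B → Colour) (t : Triple m A) →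
           plan colour (mapTriple f t) ≡
           (let i , cs , ps , r = plan (λ a → colour (f a)) t in i , cs , map (Prod.map f f) ps , f r)
plan-map f colour (z , xs , ys)
  rewrite sym (map-∘ colour f xs) | sym (map-∘ colour f ys)
  with i ← balancingIndex (colour (f z)) (map (λ a → colour (f a)) xs) (map (λ a → colour (f a)) ys)
  rewrite sym (map-mix f i xs ys) | sym (map-mix f i ys xs)
        | pairUp-map f colour (mix i xs ys) (z ∷ mix i ys xs)
        | sym (map-∘ colour f (mix i ys xs))
  = refl

-- Decision trees

private variable
  Q A B : Set

infixl 1 _>>=_
_>>=_ : DT Q A → (A → DT Q B) → DT Q B
leaf a      >>= f = f a
query q l r >>= f = query q (l >>= f) (r >>= f)

infixl 4 _<$>_
_<$>_ : (A → B) → DT Q A → DT Q B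
f <$> t = t >>= λ a → leaf (f a)

traverse : ∀ {n} → (A → DT Q B) → Vec A n → DT Q (Vec B n)
traverse f []       = leaf []
traverse f (a ∷ as) = f a >>= λ b → (b ∷_) <$> traverse f as

eval->>= : ∀ (t : DT Q A) (f : A → DT Q B) ρ → evalDT (t >>= f) ρ ≡ evalDT (f (evalDT t ρ)) ρ
eval->>= (leaf a)      f ρ = refl
eval->>= (query q l r) f ρ with ρ q
... | true  = eval->>= r f ρ
... | false = eval->>= l f ρ

eval-bind : ∀ (t : DT Q A) (f : A → DT Q B) {ρ a b} →
            evalDT t ρ ≡ a → evalDT (f a) ρ ≡ b → evalDT (t >>= f) ρ ≡ b
eval-bind t f {ρ} refl eq = trans (eval->>= t f ρ) eq

eval-<$> : ∀ (f : A → B) (t : DT Q A) {ρ a} → evalDT t ρ ≡ a → evalDT (f <$> t) ρ ≡ f a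
eval-<$> f t t≡a = eval-bind t _ t≡a refl

eval-traverse : ∀ {n} {f : A → DT Q B} {g : A → B} ρ → (∀ a → evalDT (f a) ρ ≡ g a) →
                (as : Vec A n) → evalDT (traverse f as) ρ ≡ map g as
eval-traverse ρ f≗g []       = refl
eval-traverse {f = f} ρ f≗g (a ∷ as) = trans (eval->>= (f a) _ ρ) (trans (eval->>= (traverse f as) _ ρ)
  (cong₂ _∷_ (f≗g a) (eval-traverse ρ f≗g as)))

depth->>= : ∀ {m n} (t : DT Q A) {f : A → DT Q B} → depth t ≤ m → (∀ a → depth (f a) ≤ n) →
            depth (t >>= f) ≤ m + n
depth->>= {m = m} (leaf a) t≤ f≤ = ≤-trans (f≤ a) (m≤n+m _ m)
depth->>= (query q l r) (s≤s t≤) f≤ =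
  s≤s (⊔-lub (depth->>= l (m⊔n≤o⇒m≤o _ _ t≤) f≤) (depth->>= r (m⊔n≤o⇒n≤o _ _ t≤) f≤))

depth-<$> : ∀ {m} (f : A → B) (t : DT Q A) → depth t ≤ m → depth (f <$> t) ≤ m
depth-<$> f t t≤ = subst (depth (f <$> t) ≤_) (+-identityʳ _) (depth->>= t t≤ λ _ → z≤n)

depth-traverse : ∀ {n d} {f : A → DT Q B} → (∀ a → depth (f a) ≤ d) →
                 (as : Vec A n) → depth (traverse f as) ≤ n * d
depth-traverse f≤ []       = z≤n
depth-traverse {f = f} f≤ (a ∷ as) = depth->>= (f a) (f≤ a) λ b → depth-<$> (b ∷_) _ (depth-traverse f≤ as)

-- Binary encodings and reading whole values

fromBits : ∀ n → (Fin n → Bool) → ℕ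
-- The least significant bit comes first, as in `bitAt`.
fromBits zero    β = 0
fromBits (suc n) β = (if β zero then 1 else 0) + fromBits n (λ b → β (suc b)) * 2

fromBits-cong : ∀ n {β β′ : Fin n → Bool} → (∀ b → β b ≡ β′ b) → fromBits n β ≡ fromBits n β′
fromBits-cong zero    β≗β′ = refl
fromBits-cong (suc n) β≗β′ =
  cong₂ (λ c v → (if c then 1 else 0) + v * 2) (β≗β′ zero) (fromBits-cong n λ b → β≗β′ (suc b))

fromBits-bitAt : ∀ n {v} → v ℕ.< 2 ^ n → fromBits n (λ b → bitAt v (toℕ b)) ≡ v
fromBits-bitAt zero    {zero}  _         = refl
fromBits-bitAt zero    {suc v} (s≤s ())
fromBits-bitAt (suc n) {v}     v<        = trans
  (cong₂ (λ a b → a + b * 2) (parity (v % 2) (m%n<n v 2))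
    (fromBits-bitAt n (m<n*o⇒m/o<n (subst (ℕ._<_ v) (*-comm 2 (2 ^ n)) v<))))
  (sym (m≡m%n+[m/n]*n v 2))
  where
  parity : ∀ r → r ℕ.< 2 → (if r ≡ᵇ 1 then 1 else 0) ≡ r
  parity 0 _ = refl
  parity 1 _ = refl
  parity (suc (suc r)) (s≤s (s≤s ()))

readBits : ∀ n → (Fin n → Q) → DT Q ℕ
readBits zero    q = leaf 0
readBits (suc n) q = query (q zero) ((λ v → 0 + v * 2) <$> rest) ((λ v → 1 + v * 2) <$> rest)
  where rest = readBits n (λ b → q (suc b))

eval-readBits : ∀ n (q : Fin n → Q) ρ → evalDT (readBits n q) ρ ≡ fromBits n (λ b → ρ (q b))
eval-readBits zero    q ρ = refl
eval-readBits (suc n) q ρ with ρ (q zero)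
... | true  = trans (eval->>= rest _ ρ) (cong (λ v → 1 + v * 2) (eval-readBits n _ ρ))
  where rest = readBits n (λ b → q (suc b))
... | false = trans (eval->>= rest _ ρ) (cong (λ v → 0 + v * 2) (eval-readBits n _ ρ))
  where rest = readBits n (λ b → q (suc b))

depth-readBits : ∀ n (q : Fin n → Q) → depth (readBits n q) ≤ n
depth-readBits zero    q = z≤n
depth-readBits (suc n) q = s≤s (⊔-lub (depth-<$> _ rest (depth-readBits n _)) (depth-<$> _ rest (depth-readBits n _)))
  where rest = readBits n (λ b → q (suc b))

-- Induction on `k` through `⌈ n /2⌉`: halving lowers the logarithm by one, and `n` is at most twice
-- that half.
⌈log₂n⌉≤k⇒n≤2^k : ∀ k n → ⌈log₂ n ⌉ ≤ k → n ≤ 2 ^ k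
⌈log₂n⌉≤k⇒n≤2^k zero    0             _   = z≤n
⌈log₂n⌉≤k⇒n≤2^k zero    1             _   = ≤-refl
⌈log₂n⌉≤k⇒n≤2^k zero    (suc (suc n)) ()
⌈log₂n⌉≤k⇒n≤2^k (suc k) n             log≤ = begin
  n                     ≡⟨ ⌊n/2⌋+⌈n/2⌉≡n n ⟨
  ⌊ n /2⌋ + ⌈ n /2⌉     ≤⟨ +-mono-≤ (≤-trans (⌊n/2⌋≤⌈n/2⌉ n) half≤) half≤ ⟩
  2 ^ k + 2 ^ k         ≡⟨ cong (_+_ (2 ^ k)) (+-identityʳ (2 ^ k)) ⟨
  2 ^ suc k             ∎
  where
  open ≤-Reasoning
  half≤ : ⌈ n /2⌉ ≤ 2 ^ k
  half≤ = ⌈log₂n⌉≤k⇒n≤2^k k ⌈ n /2⌉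
    (subst (_≤ k) (sym (⌈log₂⌈n/2⌉⌉≡⌈log₂n⌉∸1 n)) (∸-monoˡ-≤ 1 log≤))

n≤2^k⇒⌈log₂n⌉≤k : ∀ {n} k → n ≤ 2 ^ k → ⌈log₂ n ⌉ ≤ k
n≤2^k⇒⌈log₂n⌉≤k {n} k n≤ = subst (⌈log₂ n ⌉ ≤_) (⌈log₂2^n⌉≡n k) (⌈log₂⌉-mono-≤ n≤)

n≤2^⌈log₂n⌉ : ∀ n → n ≤ 2 ^ ⌈log₂ n ⌉
n≤2^⌈log₂n⌉ n = ⌈log₂n⌉≤k⇒n≤2^k ⌈log₂ n ⌉ n ≤-refl

toℕ-mod : ∀ {m n} .{{_ : NonZero n}} → m ℕ.< n → toℕ (m mod n) ≡ m
toℕ-mod {m} {n} m<n = trans (toℕ-fromℕ< (m%n<n m n)) (m<n⇒m%n≡m m<n)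

module _ (P : QProblem) where

  fromAnswers : ∀ x k a → fromBits (bitsFor (rng P k)) (λ b → answer P x (k , a , b)) ≡ toℕ (x k a)
  fromAnswers x k a = fromBits-bitAt (bitsFor (rng P k)) (<-≤-trans (toℕ<n (x k a)) (n≤2^⌈log₂n⌉ (rng P k)))

  -- `bitsFor r` bits suffice to write every number below `r`, so agreement on all queries is
  -- agreement of the functions.
  answers-determine : ∀ {x y : Input P} → (∀ q → answer P x q ≡ answer P y q) → ∀ k a → x k a ≡ y k a
  answers-determine {x} {y} x≗y k a = toℕ-injective (trans (sym (fromAnswers x k a))
    (trans (fromBits-cong (bitsFor (rng P k)) λ b → x≗y (k , a , b)) (fromAnswers y k a)))

  abstract

    -- The reduction `mod` gives a default on bit patterns outside the range; on the answers of an
    -- actual input it is the identity.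
    readValue : ∀ k (a : Fin (dom P k)) .{{_ : NonZero (rng P k)}} → DT (Query P) (Fin (rng P k))
    readValue k a = (_mod rng P k) <$> readBits (bitsFor (rng P k)) (λ b → k , a , b)

    eval-readValue : ∀ x k a .{{_ : NonZero (rng P k)}} → evalDT (readValue k a) (answer P x) ≡ x k a
    eval-readValue x k a = toℕ-injective (begin
      toℕ (evalDT (readValue k a) (answer P x))
        ≡⟨ cong toℕ (eval->>= (readBits n q) _ _) ⟩
      toℕ (evalDT (readBits n q) (answer P x) mod rng P k)
        ≡⟨ cong (λ v → toℕ (v mod rng P k)) (trans (eval-readBits n q _) (fromAnswers x k a)) ⟩
      toℕ (toℕ (x k a) mod rng P k)
        ≡⟨ toℕ-mod (toℕ<n (x k a)) ⟩
      toℕ (x k a) ∎)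
      where
      open ≡-Reasoning
      n : ℕ
      n = bitsFor (rng P k)
      q : Fin n → Query P
      q b = k , a , b

    depth-readValue : ∀ k a .{{_ : NonZero (rng P k)}} → depth (readValue k a) ≤ bitsFor (rng P k)
    depth-readValue k a = depth-<$> (_mod rng P k) _ (depth-readBits (bitsFor (rng P k)) _)

-- It is enough to compute whole values of the target functions.
module ToLossyCode (P : QProblem) (M : ℕ)
  (fTree : Fin M → DT (Query P) (Fin (2 * M)))
  (gTree : Fin (2 * M) → DT (Query P) (Fin M))
  (sTree : Fin (2 * M) → DT (Query P) (Sol P)) where

  T : QProblem
  T = LossyCode M

  valueTree : ∀ k → Fin (dom T k) → DT (Query P) (Fin (rng T k))
  valueTree zero       = fTree
  valueTree (suc zero) = gTree

  target : Input P → Input T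
  target x k a = evalDT (valueTree k a) (answer P x)

  bits : Query T → DT (Query P) Bool
  bits (k , a , b) = (λ v → bitAt (toℕ v) (toℕ b)) <$> valueTree k a

  bits-target : ∀ x q → answer T (target x) q ≡ evalDT (bits q) (answer P x)
  bits-target x (k , a , b) = sym (eval->>= (valueTree k a) _ (answer P x))

  reduction : (∀ x s → target x zero (target x (suc zero) s) ≢ s →
               IsSol P x (evalDT (sTree s) (answer P x))) →
              DTReduction P T
  reduction sound = record
    { bitTree = bits
    ; solTree = sTree
    ; valid   = λ x → target x , bits-target x
    -- Any `y` computed from `x` agrees pointwise with `target x`, so each solution for `y` is one
    -- for `target x`.
    ; correct = λ x y computes s fgs≢s → sound x s λ eq →
        let y≗ = answers-determine T {y} {target x} λ q → trans (computes q) (sym (bits-target x q))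
        in fgs≢s (trans (y≗ zero _) (trans (cong (target x zero) (y≗ (suc zero) s)) eq))
    }

  depth-bits : ∀ {d} → (∀ a → depth (fTree a) ≤ d) → (∀ s → depth (gTree s) ≤ d) →
               ∀ q → depth (bits q) ≤ d
  depth-bits f≤ g≤ (zero , a , b)     = depth-<$> _ (fTree a) (f≤ a)
  depth-bits f≤ g≤ (suc zero , s , b) = depth-<$> _ (gTree s) (g≤ s)

-- The reduction

funToFin-cong : ∀ {m n} {f g : Fin m → Fin n} → (∀ i → f i ≡ g i) → funToFin f ≡ funToFin g
funToFin-cong {zero}  f≗g = refl
funToFin-cong {suc m} f≗g = cong₂ combine (f≗g zero) (funToFin-cong λ i → f≗g (suc i))

Vec↔Fin : ∀ {k} n → Vec (Fin k) n ↔ Fin (k ^ n)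
Vec↔Fin {k} n = mk↔ₛ′ (λ v → funToFin (lookup v)) (λ i → tabulate (finToFun i))
  (λ i → trans (funToFin-cong (lookup∘tabulate (finToFun {k} {n} i))) (funToFin-finToFin {n} i))
  (λ v → trans (tabulate-cong (finToFun-funToFin (lookup v))) (tabulate∘lookup v))

infixr 5 _×↔Fin_
_×↔Fin_ : ∀ {A B : Set} {a b} → A ↔ Fin a → B ↔ Fin b → (A × B) ↔ Fin (a * b)
A↔ ×↔Fin B↔ = ↔-sym *↔× ↔-∘ (A↔ ×-↔ B↔)

triple↔Fin : ∀ n m → Triple m (Fin n) ↔ Fin (n * (n ^ m * n ^ m))
triple↔Fin n m = ↔-id _ ×↔Fin Vec↔Fin m ×↔Fin Vec↔Fin m

plan↔Fin : ∀ n h m → Plan m (Fin n) (Fin h) ↔ Fin (suc m * (2 ^ suc m * (h ^ m * n)))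
plan↔Fin n h m = ↔-id _ ×↔Fin Vec↔Fin (suc m) ×↔Fin Vec↔Fin m ×↔Fin ↔-id _

module _ {A : Set} (_≟ₐ_ : DecidableEquality A) where

  firstMismatch : ∀ {n} → A → Vec (A × A) n → A
  firstMismatch d []             = d
  firstMismatch d ((a , b) ∷ ps) with a ≟ₐ b
  ... | yes _ = firstMismatch d ps
  ... | no  _ = a

  -- Turns the failure of `φ` to fix a whole vector into one entry that it moves, while keeping a
  -- property `R` shared by all entries. The default `d` is not reached, since without a mismatch
  -- `φ` would fix the vector.
  firstMismatch-correct : ∀ {R : A → Set} {n} {φ : A → A} d {as : Vec A n} → All R as → map φ as ≢ as →
    let a = firstMismatch d (map (λ a → a , φ a) as) in R a × φ a ≢ a
  firstMismatch-correct d []       φas≢as = contradiction refl φas≢as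
  firstMismatch-correct {φ = φ} d {a ∷ as} (r ∷ rs) φas≢as with a ≟ₐ φ a
  ... | yes a≡φa = firstMismatch-correct d rs λ eq → φas≢as (cong₂ _∷_ (sym a≡φa) eq)
  ... | no  a≢φa = r , λ eq → a≢φa (sym eq)

module DualToLossy (c : ℚ) (N m : ℕ) .{{_ : NonZero N}} .{{_ : NonZero (Hsize c N)}} where

  n h M : ℕ
  n = 2 * N
  h = Hsize c N
  -- `M` counts the plans with pairs stored in `H`. The pigeons of the target instance will be the
  -- first `2 * M` triples.
  M = suc m * (2 ^ suc m * (h ^ m * n))

  instance
    n≢0 : NonZero n
    n≢0 = m*n≢0 2 N

    M≢0 : NonZero M
    M≢0 = m*n≢0 (suc m) _ {{_}} {{m*n≢0 (2 ^ suc m) _ {{m^n≢0 2 (suc m)}} {{m*n≢0 (h ^ m) n {{m^n≢0 h m}}}}}}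

    2M≢0 : NonZero (2 * M)
    2M≢0 = m*n≢0 2 M

  P : QProblem
  P = DualAMGMLC c N

  V H : Set
  V = Fin n
  H = Fin h

  Tree : Set → Set
  Tree = DT (Query P)

  readC : V → Tree Colour
  readC v = readValue P zero v

  readF : H → Tree (V × V)
  readF a = readValue P (suc zero) a >>= λ u → (u ,_) <$> readValue P (suc (suc zero)) a

  readG : V × V → Tree H
  readG (u , v) = readValue P (suc (suc (suc zero))) (combine u v)

  -- Vertices carry their queried colours along, so that `plan` and `assemble` run with the colour
  -- function `proj₂` and ask no further queries.
  readTag : V → Tree (V × Colour)
  readTag v = (v ,_) <$> readC v

  readTaggedF : H → Tree ((V × Colour) × (V × Colour))
  readTaggedF a = readF a >>= λ (u , v) → readTag u >>= λ u′ → (u′ ,_) <$> readTag v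

  readTriple : Triple m V → Tree (Triple m (V × Colour))
  readTriple (z , xs , ys) =
    readTag z >>= λ z′ → traverse readTag xs >>= λ xs′ → (λ ys′ → z′ , xs′ , ys′) <$> traverse readTag ys

  untagPlan : Plan m (V × Colour) ((V × Colour) × (V × Colour)) → Plan m V (V × V)
  untagPlan (i , cs , ps , r) = i , cs , map (Prod.map proj₁ proj₁) ps , proj₁ r

  readPlan : Triple m V → Tree (Plan m V (V × V))
  readPlan t = (λ t′ → untagPlan (plan proj₂ t′)) <$> readTriple t

  encode : Triple m V → Tree (Plan m V H)
  encode t = readPlan t >>= λ (i , cs , ps , r) → (λ hs → i , cs , hs , r) <$> traverse readG ps

  decode : Plan m V H → Tree (Triple m V)
  decode (i , cs , hs , r) = traverse readTaggedF hs >>= λ ps →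
    (λ r′ → mapTriple proj₁ (assemble proj₂ (i , cs , ps , r′))) <$> readTag r

  readRoundTrip : V × V → Tree ((V × V) × (V × V))
  readRoundTrip p = readG p >>= λ a → (p ,_) <$> readF a

  _≟ₚ_ : DecidableEquality (V × V)
  _≟ₚ_ = ≡-dec Fin._≟_ Fin._≟_

  search : Triple m V → Tree (V × V)
  search t@(z , _) = readPlan t >>= λ (i , cs , ps , r) →
    -- The pair `(z , z)` is a default for triples all of whose round trips succeed.
    firstMismatch _≟ₚ_ (z , z) <$> traverse readRoundTrip ps

  -- Query depth of the trees

  w : ℕ
  w = bitsFor n

  depth-readF : ∀ a → depth (readF a) ≤ w + w
  depth-readF a = depth->>= (readValue P (suc zero) a) (depth-readValue P (suc zero) a) λ u →
    depth-<$> (u ,_) _ (depth-readValue P (suc (suc zero)) a)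

  depth-readG : ∀ p → depth (readG p) ≤ bitsFor h
  depth-readG (u , v) = depth-readValue P (suc (suc (suc zero))) (combine u v)

  depth-readTag : ∀ v → depth (readTag v) ≤ 1
  depth-readTag v = depth-<$> (v ,_) (readC v) (depth-readValue P zero v)

  depth-readTaggedF : ∀ a → depth (readTaggedF a) ≤ w + w + (1 + 1)
  depth-readTaggedF a = depth->>= (readF a) (depth-readF a) λ (u , v) →
    depth->>= (readTag u) (depth-readTag u) λ u′ → depth-<$> (u′ ,_) (readTag v) (depth-readTag v)

  depth-readPlan : ∀ t → depth (readPlan t) ≤ 1 + (m * 1 + m * 1)
  depth-readPlan (z , xs , ys) = depth-<$> _ (readTriple (z , xs , ys))
    (depth->>= (readTag z) (depth-readTag z) λ _ →
      depth->>= (traverse readTag xs) (depth-traverse depth-readTag xs) λ _ →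
        depth-<$> _ (traverse readTag ys) (depth-traverse depth-readTag ys))

  depth-encode : ∀ t → depth (encode t) ≤ 1 + (m * 1 + m * 1) + m * bitsFor h
  depth-encode t = depth->>= (readPlan t) (depth-readPlan t) λ (_ , _ , ps , _) →
    depth-<$> _ (traverse readG ps) (depth-traverse depth-readG ps)

  depth-decode : ∀ pl → depth (decode pl) ≤ m * (w + w + (1 + 1)) + 1
  depth-decode (i , cs , hs , r) = depth->>= (traverse readTaggedF hs) (depth-traverse depth-readTaggedF hs) λ _ →
    depth-<$> _ (readTag r) (depth-readTag r)

  depth-search : ∀ t → depth (search t) ≤ 1 + (m * 1 + m * 1) + m * (bitsFor h + (w + w))
  depth-search t = depth->>= (readPlan t) (depth-readPlan t) λ (_ , _ , ps , _) →
    depth-<$> _ (traverse readRoundTrip ps) (depth-traverse (λ p →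
      depth->>= (readG p) (depth-readG p) λ a → depth-<$> (p ,_) (readF a) (depth-readF a)) ps)

  -- Behaviour of the trees on an input, and correctness of the search

  module _ (x : Input P) where

    ρ : Query P → _
    ρ = answer P x

    χ : V → Colour
    χ = x zero

    F : H → V × V
    F a = x (suc zero) a , x (suc (suc zero)) a

    G : V × V → H
    G (u , v) = x (suc (suc (suc zero))) (combine u v)

    tag : V → V × Colour
    tag v = v , χ v

    eval-readF : ∀ a → evalDT (readF a) ρ ≡ F a
    eval-readF a = eval-bind (readValue P (suc zero) a) _ (eval-readValue P x (suc zero) a)
      (eval-<$> _ (readValue P (suc (suc zero)) a) (eval-readValue P x (suc (suc zero)) a))

    eval-readG : ∀ p → evalDT (readG p) ρ ≡ G p
    eval-readG (u , v) = eval-readValue P x (suc (suc (suc zero))) (combine u v)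

    eval-readTag : ∀ v → evalDT (readTag v) ρ ≡ tag v
    eval-readTag v = eval-<$> (v ,_) (readC v) (eval-readValue P x zero v)

    eval-readTaggedF : ∀ a → evalDT (readTaggedF a) ρ ≡ Prod.map tag tag (F a)
    eval-readTaggedF a = eval-bind (readF a) _ (eval-readF a)
      (eval-bind (readTag u) _ (eval-readTag u) (eval-<$> (tag u ,_) (readTag v) (eval-readTag v)))
      where
      u = proj₁ (F a)
      v = proj₂ (F a)

    eval-readTags : (vs : Vec V m) → evalDT (traverse readTag vs) ρ ≡ map tag vs
    eval-readTags = eval-traverse ρ eval-readTag

    eval-readTriple : ∀ t → evalDT (readTriple t) ρ ≡ mapTriple tag t
    eval-readTriple (z , xs , ys) =
      eval-bind (readTag z) _ (eval-readTag z)
        (eval-bind (traverse readTag xs) _ (eval-readTags xs)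
          (eval-<$> _ (traverse readTag ys) (eval-readTags ys)))

    untag² : ∀ (ps : Vec (V × V) m) → map (Prod.map proj₁ proj₁) (map (Prod.map tag tag) ps) ≡ ps
    untag² ps = trans (sym (map-∘ _ _ ps)) (map-id ps)

    eval-readPlan : ∀ t → evalDT (readPlan t) ρ ≡ plan χ t
    eval-readPlan t = trans (eval-<$> _ (readTriple t) (eval-readTriple t))
      (trans (cong untagPlan (plan-map tag proj₂ t))
             (let i , cs , ps , r = plan χ t in cong (λ qs → i , cs , qs , r) (untag² ps)))

    eval-encode : ∀ t → evalDT (encode t) ρ ≡ (let i , cs , ps , r = plan χ t in i , cs , map G ps , r)
    eval-encode t = let i , cs , ps , r = plan χ t in
      eval-bind (readPlan t) _ (eval-readPlan t)
        (eval-<$> (λ hs → i , cs , hs , r) (traverse readG ps) (eval-traverse ρ eval-readG ps))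

    eval-decode : ∀ pl → evalDT (decode pl) ρ ≡
                  (let i , cs , hs , r = pl
                   in mapTriple proj₁ (assemble proj₂ (i , cs , map (λ a → Prod.map tag tag (F a)) hs , tag r)))
    eval-decode (i , cs , hs , r) =
      eval-bind (traverse readTaggedF hs) _ (eval-traverse ρ eval-readTaggedF hs)
        (eval-<$> _ (readTag r) (eval-readTag r))

    eval-readRoundTrip : ∀ p → evalDT (readRoundTrip p) ρ ≡ (p , F (G p))
    eval-readRoundTrip p = eval-bind (readG p) _ (eval-readG p)
      (eval-<$> (p ,_) (readF (G p)) (eval-readF (G p)))

    planPairs : Triple m V → Vec (V × V) m
    planPairs t = proj₁ (proj₂ (proj₂ (plan χ t)))

    eval-search : ∀ t → evalDT (search t) ρ ≡
                  firstMismatch _≟ₚ_ (proj₁ t , proj₁ t) (map (λ p → p , F (G p)) (planPairs t))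
    eval-search t = eval-bind (readPlan t) _ (eval-readPlan t)
      (eval-<$> _ (traverse readRoundTrip (planPairs t)) (eval-traverse ρ eval-readRoundTrip (planPairs t)))

    -- If `F` undoes `G` on every pair of the plan, the decoder recovers those pairs and tags them.
    -- By `plan-map` it then holds the plan of the tagged triple, which `assemble` inverts; dropping
    -- the tags gives `t`.
    decode-encode : ∀ t → map (λ p → F (G p)) (planPairs t) ≡ planPairs t →
                    evalDT (decode (evalDT (encode t) ρ)) ρ ≡ t
    decode-encode t FG≡id = begin
      evalDT (decode (evalDT (encode t) ρ)) ρ
        ≡⟨ cong (λ pl → evalDT (decode pl) ρ) (eval-encode t) ⟩
      evalDT (decode (i , cs , map G ps , r)) ρ
        ≡⟨ eval-decode (i , cs , map G ps , r) ⟩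
      untag (map (λ a → tag² (F a)) (map G ps))
        ≡⟨ cong untag (trans (sym (map-∘ _ G ps)) (trans (map-∘ tag² (λ p → F (G p)) ps) (cong (map tag²) FG≡id))) ⟩
      untag (map tag² ps)
        ≡⟨ cong (λ pl → mapTriple proj₁ (assemble proj₂ pl)) (plan-map tag proj₂ t) ⟨
      mapTriple proj₁ (assemble proj₂ (plan proj₂ (mapTriple tag t)))
        ≡⟨ cong (mapTriple proj₁) (assemble-plan proj₂ (mapTriple tag t)) ⟩
      mapTriple proj₁ (mapTriple tag t)
        ≡⟨ cong₂ (λ xs ys → proj₁ t , xs , ys) (untag-tag (proj₁ (proj₂ t))) (untag-tag (proj₂ (proj₂ t))) ⟩
      t ∎
      where
      open ≡-Reasoning
      i  = proj₁ (plan χ t)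
      cs = proj₁ (proj₂ (plan χ t))
      ps = planPairs t
      r  = proj₂ (proj₂ (proj₂ (plan χ t)))
      tag² = Prod.map tag tag
      untag : Vec ((V × Colour) × (V × Colour)) m → Triple m V
      untag qs = mapTriple proj₁ (assemble proj₂ (i , cs , qs , tag r))
      untag-tag : (vs : Vec V m) → map proj₁ (map tag vs) ≡ vs
      untag-tag vs = trans (sym (map-∘ proj₁ tag vs)) (map-id vs)

    -- By the contrapositive of `decode-encode`, some pair of the plan is moved by `F` after `G`.
    -- Balancing made every pair of the plan monochromatic, so the pair found lies in the pigeon
    -- set.
    search-correct : ∀ t → evalDT (decode (evalDT (encode t) ρ)) ρ ≢ t →
                     IsSol P x (evalDT (search t) ρ)
    search-correct t decode≢t = subst (IsSol P x) (sym (eval-search t))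
      (firstMismatch-correct _≟ₚ_ {R = Monochromatic χ} _ (plan-monochromatic χ t)
        λ FG≡id → decode≢t (decode-encode t FG≡id))

  module _ (fits : 2 * M ≤ n * (n ^ m * n ^ m)) where

    open module Triples = Inverse (triple↔Fin n m) using () renaming (to to packTriple; from to unpackTriple)
    open module Plans = Inverse (plan↔Fin n h m) using () renaming (to to packPlan; from to unpackPlan)

    -- Junk value: triples beyond the first 2M are reduced modulo 2M.
    toPigeon : Triple m V → Fin (2 * M)
    toPigeon t = toℕ (packTriple t) mod (2 * M)

    fromPigeon : Fin (2 * M) → Triple m V
    fromPigeon s = unpackTriple (inject≤ s fits)

    toPigeon-fromPigeon : ∀ s → toPigeon (fromPigeon s) ≡ s
    toPigeon-fromPigeon s = toℕ-injective (begin
      toℕ (toPigeon (fromPigeon s))            ≡⟨ cong (λ i → toℕ (toℕ i mod (2 * M))) (Triples.strictlyInverseˡ (inject≤ s fits)) ⟩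
      toℕ (toℕ (inject≤ s fits) mod (2 * M))   ≡⟨ cong (λ i → toℕ (i mod (2 * M))) (toℕ-inject≤ s fits) ⟩
      toℕ (toℕ s mod (2 * M))                  ≡⟨ toℕ-mod (toℕ<n s) ⟩
      toℕ s                                    ∎)
      where open ≡-Reasoning

    fTree : Fin M → Tree (Fin (2 * M))
    fTree a = toPigeon <$> decode (unpackPlan a)

    gTree : Fin (2 * M) → Tree (Fin M)
    gTree s = packPlan <$> encode (fromPigeon s)

    depth-fTree : ∀ a → depth (fTree a) ≤ m * (w + w + (1 + 1)) + 1
    depth-fTree a = depth-<$> toPigeon (decode (unpackPlan a)) (depth-decode (unpackPlan a))

    depth-gTree : ∀ s → depth (gTree s) ≤ 1 + (m * 1 + m * 1) + m * bitsFor h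
    depth-gTree s = depth-<$> packPlan (encode (fromPigeon s)) (depth-encode (fromPigeon s))

    sTree : Fin (2 * M) → Tree (V × V)
    sTree s = search (fromPigeon s)

    open ToLossyCode P M fTree gTree sTree public

    -- The packing of the plan by `g` is cancelled by its unpacking in `f`, leaving encoding
    -- followed by decoding.
    fg-decode-encode : ∀ x s → target x zero (target x (suc zero) s) ≡
                       toPigeon (evalDT (decode (evalDT (encode (fromPigeon s)) (answer P x))) (answer P x))
    fg-decode-encode x s = trans
      (cong (λ a → evalDT (fTree a) ρ′) (eval-<$> packPlan (encode t) refl))
      (eval-<$> toPigeon (decode (unpackPlan (packPlan e))) (cong (λ pl → evalDT (decode pl) ρ′) (Plans.strictlyInverseʳ e)))
      where
      ρ′ = answer P x
      t = fromPigeon s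
      e = evalDT (encode t) ρ′

    dualReduction : DTReduction P T
    dualReduction = reduction λ x s fgs≢s → search-correct x (fromPigeon s) λ eq →
      fgs≢s (trans (fg-decode-encode x s) (trans (cong toPigeon eq) (toPigeon-fromPigeon s)))

-- Sizes

^-distribʳ-* : ∀ o m n → (m * n) ^ o ≡ m ^ o * n ^ o
^-distribʳ-* zero    m n = refl
^-distribʳ-* (suc o) m n = trans (cong (m * n *_) (^-distribʳ-* o m n)) (interchange m n (m ^ o) (n ^ o))
  where
  interchange : ∀ a b c d → a * b * (c * d) ≡ a * c * (b * d)
  interchange = solve-∀

-- Bernoulli's inequality `1 + r/p ≤ (1 + 1/p)^r`, multiplied by `p ^ r * p` to avoid fractions.
bernoulli : ∀ p r → p ^ r * (p + r) ≤ suc p ^ r * p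
bernoulli p zero    = ≤-reflexive (cong (1 *_) (+-identityʳ p))
bernoulli p (suc r) = begin
  p * p ^ r * (p + suc r)          ≤⟨ m≤m+n _ (p ^ r * r) ⟩
  p * p ^ r * (p + suc r) + p ^ r * r  ≡⟨ regroup p (p ^ r) r ⟩
  suc p * (p ^ r * (p + r))        ≤⟨ *-monoʳ-≤ (suc p) (bernoulli p r) ⟩
  suc p * (suc p ^ r * p)          ≡⟨ *-assoc (suc p) (suc p ^ r) p ⟨
  suc p * suc p ^ r * p            ∎
  where
  open ≤-Reasoning
  regroup : ∀ p P r → p * P * (p + (1 + r)) + P * r ≡ (1 + p) * (P * (p + r))
  regroup = solve-∀

bernoulli-cancelled : ∀ p s .{{_ : NonZero p}} → p ^ (p * s) * (1 + s) ≤ suc p ^ (p * s)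
bernoulli-cancelled p s = *-cancelʳ-≤ _ _ p (begin
  p ^ (p * s) * (1 + s) * p    ≡⟨ regroup p s (p ^ (p * s)) ⟩
  p ^ (p * s) * (p + p * s)    ≤⟨ bernoulli p (p * s) ⟩
  suc p ^ (p * s) * p          ∎)
  where
  open ≤-Reasoning
  regroup : ∀ p s P → P * (1 + s) * p ≡ P * (p + p * s)
  regroup = solve-∀

-- Bernoulli's inequality with exponent p s gives (1 + 1/p)^(2ps) ≥ (1 + s)², which is
-- at least 4 (2ps + 1) for s = 8p + 2.
blockLength : ℕ → ℕ
blockLength p = p * (8 * p + 2) + p * (8 * p + 2)

linear≤exponential : ∀ p .{{_ : NonZero p}} → let m = blockLength p in
                     4 * suc m * p ^ m ≤ suc p ^ m
linear≤exponential p = begin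
  -- The padding `32 * p + 5` equals `(1 + s)² − 4 (2 e + 1)` and completes the coefficient to the
  -- square `(1 + s)²`.
  4 * suc (e + e) * p ^ (e + e)              ≤⟨ *-monoˡ-≤ (p ^ (e + e)) (m≤m+n (4 * suc (e + e)) (32 * p + 5)) ⟩
  (4 * suc (e + e) + (32 * p + 5)) * p ^ (e + e)
    ≡⟨ cong ((4 * suc (e + e) + (32 * p + 5)) *_) (^-distribˡ-+-* p e e) ⟩
  (4 * suc (e + e) + (32 * p + 5)) * (p ^ e * p ^ e)
    ≡⟨ square p (p ^ e) ⟩
  p ^ e * (1 + s) * (p ^ e * (1 + s))        ≤⟨ *-mono-≤ (bernoulli-cancelled p s) (bernoulli-cancelled p s) ⟩
  suc p ^ e * suc p ^ e                      ≡⟨ ^-distribˡ-+-* (suc p) e e ⟨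
  suc p ^ (e + e)                            ∎
  where
  open ≤-Reasoning
  s = 8 * p + 2
  e = p * s
  square : ∀ p P → (4 * (1 + (p * (8 * p + 2) + p * (8 * p + 2))) + (32 * p + 5)) * (P * P)
                 ≡ P * (1 + (8 * p + 2)) * (P * (1 + (8 * p + 2)))
  square = solve-∀

-- After division by `n` the claim is `4 (m + 1) (2 h)^m ≤ (n²)^m`. As `h` is at most `(p/q) N²`, it
-- reduces to `4 (m + 1) p^m ≤ (2 q)^m`; the comparison is made after multiplying by `q ^ m`.
codes-fit : ∀ {p q h N m} .{{_ : NonZero q}} → h * q ≤ p * (N * N) → p ℕ.< 2 * q →
            4 * suc m * p ^ m ≤ suc p ^ m →
            2 * (suc m * (2 ^ suc m * (h ^ m * (2 * N)))) ≤ 2 * N * ((2 * N) ^ m * (2 * N) ^ m)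
codes-fit {p} {q} {h} {N} {m} hq≤ p<2q grows = begin
  2 * (suc m * (2 ^ suc m * (h ^ m * n)))   ≡⟨ regroup (suc m) (2 ^ m) (h ^ m) n ⟩
  n * (4 * suc m * (2 ^ m * h ^ m))         ≡⟨ cong (λ t → n * (4 * suc m * t)) (^-distribʳ-* m 2 h) ⟨
  n * (4 * suc m * (2 * h) ^ m)             ≤⟨ *-monoʳ-≤ n cancelled ⟩
  n * (n * n) ^ m                           ≡⟨ cong (n *_) (^-distribʳ-* m n n) ⟩
  n * (n ^ m * n ^ m)                       ∎
  where
  open ≤-Reasoning
  n = 2 * N
  regroup : ∀ k a b n → 2 * (k * (2 * a * (b * n))) ≡ n * (4 * k * (a * b))
  regroup = solve-∀
  pull : ∀ p N → 2 * (p * (N * N)) ≡ p * (2 * (N * N))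
  pull = solve-∀
  push : ∀ q N → 2 * q * (2 * (N * N)) ≡ 2 * N * (2 * N) * q
  push = solve-∀
  cancelled : 4 * suc m * (2 * h) ^ m ≤ (n * n) ^ m
  cancelled = *-cancelʳ-≤ _ _ (q ^ m) {{m^n≢0 q m}} (begin
    4 * suc m * (2 * h) ^ m * q ^ m           ≡⟨ *-assoc (4 * suc m) ((2 * h) ^ m) (q ^ m) ⟩
    4 * suc m * ((2 * h) ^ m * q ^ m)         ≡⟨ cong (4 * suc m *_) (^-distribʳ-* m (2 * h) q) ⟨
    4 * suc m * (2 * h * q) ^ m               ≡⟨ cong (λ t → 4 * suc m * t ^ m) (*-assoc 2 h q) ⟩
    4 * suc m * (2 * (h * q)) ^ m             ≤⟨ *-monoʳ-≤ (4 * suc m) (^-monoˡ-≤ m (*-monoʳ-≤ 2 hq≤)) ⟩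
    4 * suc m * (2 * (p * (N * N))) ^ m       ≡⟨ cong (λ t → 4 * suc m * t ^ m) (pull p N) ⟩
    4 * suc m * (p * (2 * (N * N))) ^ m       ≡⟨ cong (4 * suc m *_) (^-distribʳ-* m p _) ⟩
    4 * suc m * (p ^ m * (2 * (N * N)) ^ m)   ≡⟨ *-assoc (4 * suc m) (p ^ m) _ ⟨
    -- Here `c < 2` enters: for integers `p < 2 q` means `p + 1 ≤ 2 q`, so the growth of
    -- `((p + 1)/p)^m` absorbs the factor `4 (m + 1)`.
    4 * suc m * p ^ m * (2 * (N * N)) ^ m     ≤⟨ *-monoˡ-≤ _ (≤-trans grows (^-monoˡ-≤ m p<2q)) ⟩
    (2 * q) ^ m * (2 * (N * N)) ^ m           ≡⟨ ^-distribʳ-* m (2 * q) _ ⟨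
    (2 * q * (2 * (N * N))) ^ m               ≡⟨ cong (_^ m) (push q N) ⟩
    (n * n * q) ^ m                           ≡⟨ ^-distribʳ-* m (n * n) q ⟩
    (n * n) ^ m * q ^ m                       ∎)

-- The size of `H` in terms of the numerator and denominator of `c`

floor-scaled-≤ : ∀ (r : ℚ) p q k → ↥ r ℤ.* + suc q ≡ + p ℤ.* + k ℤ.* ℚ.↧ r →
                 ∣ floor r ∣ * suc q ≤ p * k
floor-scaled-≤ (mkℚ -[1+ a ] b _) p q k eq
  rewrite sym (ℤ.pos-* p k) | sym (ℤ.pos-* (p * k) (suc b)) = contradiction eq λ ()
floor-scaled-≤ (mkℚ (+ a) b _) p q k eq = *-cancelʳ-≤ _ _ (suc b) (begin
  ∣ + 1 ℤ.* + a/b ∣ * suc q * suc b   ≡⟨ cong (λ i → ∣ i ∣ * suc q * suc b) (ℤ.*-identityˡ (+ a/b)) ⟩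
  a/b * suc q * suc b                 ≡⟨ swapʳ a/b (suc q) (suc b) ⟩
  a/b * suc b * suc q                 ≤⟨ *-monoˡ-≤ (suc q) (m/n*n≤m a (suc b)) ⟩
  a * suc q                           ≡⟨ ℤ.+-injective eqℕ ⟩
  p * k * suc b                       ∎)
  where
  open ≤-Reasoning
  a/b = a ℕ./ suc b
  swapʳ : ∀ x y z → x * y * z ≡ x * z * y
  swapʳ = solve-∀
  eqℕ : + (a * suc q) ≡ + (p * k * suc b)
  eqℕ = trans (ℤ.pos-* a (suc q)) (trans eq (trans (cong (ℤ._* + suc b) (sym (ℤ.pos-* p k))) (sym (ℤ.pos-* (p * k) (suc b)))))

-- The product `c N²` is reduced to lowest terms, so its numerator and denominator are only known
-- through cross multiplication. That equation comes from the unnormalised product; the rest is that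
-- a floor is at most its argument.
Hsize-≤ : ∀ c {p} N → ↥ c ≡ + p → Hsize c N * ↧ₙ c ≤ p * (N * N)
Hsize-≤ c@(mkℚ (+ p) q _) N refl = floor-scaled-≤ r p q (N * N) eq
  where
  r = c ℚ.* (+ (N * N) ℚ./ 1)
  r≃ : ℚ.toℚᵘ r ℚᵘ.≃ mkℚᵘ (+ p) q ℚᵘ.* mkℚᵘ (+ (N * N)) 0
  r≃ = ℚᵘ.≃-trans (ℚ.toℚᵘ-homo-* c (+ (N * N) ℚ./ 1))
         (ℚᵘ.*-congˡ {mkℚᵘ (+ p) q} (ℚ.toℚᵘ-fromℚᵘ (mkℚᵘ (+ (N * N)) 0)))
  eq : ↥ r ℤ.* + suc q ≡ + p ℤ.* + (N * N) ℤ.* ℚ.↧ r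
  eq with *≡* e ← r≃ = begin
    ↥ r ℤ.* + suc q                     ≡⟨ cong₂ (λ i d → i ℤ.* + suc d) (ℚ.↥ᵘ-toℚᵘ r) (*-identityʳ q) ⟨
    ℚᵘ.↥ ℚ.toℚᵘ r ℤ.* + suc (q * 1)     ≡⟨ e ⟩
    + p ℤ.* + (N * N) ℤ.* ℚᵘ.↧ ℚ.toℚᵘ r ≡⟨ cong (+ p ℤ.* + (N * N) ℤ.*_) (ℚ.↧ᵘ-toℚᵘ r) ⟩
    + p ℤ.* + (N * N) ℤ.* ℚ.↧ r         ∎
    where open ≡-Reasoning

-- Ensures that a value of `G` has at most twice as many bits as the encoding of a vertex.
≤[2N]² : ∀ {h p q N} .{{_ : NonZero q}} → h * q ≤ p * (N * N) → p ℕ.< 2 * q → h ≤ 2 * N * (2 * N)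
≤[2N]² {h} {p} {q} {N} hq≤ p<2q = *-cancelʳ-≤ _ _ q (begin
  h * q                ≤⟨ hq≤ ⟩
  p * (N * N)          ≤⟨ *-monoˡ-≤ (N * N) (<⇒≤ p<2q) ⟩
  2 * q * (N * N)      ≤⟨ m≤m+n _ (2 * q * (N * N)) ⟩
  2 * q * (N * N) + 2 * q * (N * N)  ≡⟨ regroup q N ⟩
  2 * N * (2 * N) * q  ∎)
  where
  open ≤-Reasoning
  regroup : ∀ q N → 2 * q * (N * N) + 2 * q * (N * N) ≡ 2 * N * (2 * N) * q
  regroup = solve-∀

-- Serves the case of empty `H`, where `G` would map a nonempty set into the empty one and no input
-- exists.
trivialReduction : ∀ {P} → ¬ Input P → Sol P → DTReduction P (LossyCode 1)
trivialReduction ¬x s = record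
  { bitTree = λ _ → leaf false
  ; solTree = λ _ → leaf s
  ; valid   = λ x → ⊥-elim (¬x x)
  ; correct = λ x → ⊥-elim (¬x x)
  }

no-input : ∀ c N → Fin (2 * N) → Hsize c N ≡ 0 → ¬ Input (DualAMGMLC c N)
no-input c N v h≡0 x with () ← subst Fin h≡0 (x (suc (suc (suc zero))) (combine v v))

-- Complexity bounds

n<2^n : ∀ n → n ℕ.< 2 ^ n
n<2^n zero    = s≤s z≤n
n<2^n (suc n) = begin-strict
  suc n            ≤⟨ n<2^n n ⟩
  2 ^ n            <⟨ m<m+n (2 ^ n) (≤-<-trans z≤n (n<2^n n)) ⟩
  2 ^ n + 2 ^ n    ≡⟨ cong (_+_ (2 ^ n)) (+-identityʳ (2 ^ n)) ⟨
  2 ^ suc n        ∎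
  where open ≤-Reasoning

-- Each of the two blocks contributes at most `2 ^ E * 2 ^ E`, with a bit length bounded crudely by
-- `2 ^ E`; the extra 1 in the exponent pays for their sum.
log-inputLength-LossyCode : ∀ M E → 2 * M ≤ 2 ^ E → ⌈log₂ inputLength (LossyCode M) ⌉ ≤ 1 + (E + E)
log-inputLength-LossyCode M E 2M≤ = n≤2^k⇒⌈log₂n⌉≤k (1 + (E + E)) (begin
  M * bitsFor (2 * M) + (2 * M * bitsFor M + 0)  ≤⟨ +-mono-≤ (*-mono-≤ M≤ (bits≤ 2M≤)) (+-monoˡ-≤ 0 (*-mono-≤ 2M≤ (bits≤ M≤))) ⟩
  2 ^ E * 2 ^ E + (2 ^ E * 2 ^ E + 0)            ≡⟨ cong (λ t → t + (t + 0)) (^-distribˡ-+-* 2 E E) ⟨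
  2 ^ (1 + (E + E))                              ∎)
  where
  open ≤-Reasoning
  M≤ : M ≤ 2 ^ E
  M≤ = ≤-trans (m≤m+n M _) 2M≤
  bits≤ : ∀ {k} → k ≤ 2 ^ E → bitsFor k ≤ 2 ^ E
  bits≤ k≤ = ≤-trans (n≤2^k⇒⌈log₂n⌉≤k E k≤) (<⇒≤ (n<2^n E))

module _ (c : ℚ) (N m : ℕ) .{{_ : NonZero N}} .{{_ : NonZero (Hsize c N)}} where

  open DualToLossy c N m

  -- The depth of `search` with `bitsFor h` replaced by `w + w`; it dominates the trees for `f` and
  -- `g` as well.
  treeDepth : ℕ
  treeDepth = 1 + (m * 1 + m * 1) + m * (w + w + (w + w))

  dualComplexity : (fits : 2 * M ≤ n * (n ^ m * n ^ m)) → Hsize c N ≤ n * n →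
                   ComplexityAtMost (dualReduction fits) ((10 * m + 4) * (⌈log₂ N ⌉ ^ 1) + (10 * m + 4))
  dualComplexity fits h≤nn =
    treeDepth
    , depth-bits fits (λ a → ≤-trans (depth-fTree fits a) decode≤) (λ s → ≤-trans (depth-gTree fits s) encode≤)
    , (λ s → ≤-trans (depth-search (fromPigeon fits s)) search≤)
    , total≤
    where
    open ≤-Reasoning
    h≤ : bitsFor h ≤ w + w
    h≤ = n≤2^k⇒⌈log₂n⌉≤k (w + w) (begin
      h                ≤⟨ h≤nn ⟩
      n * n            ≤⟨ *-mono-≤ (n≤2^⌈log₂n⌉ n) (n≤2^⌈log₂n⌉ n) ⟩
      2 ^ w * 2 ^ w    ≡⟨ ^-distribˡ-+-* 2 w w ⟨
      2 ^ (w + w)      ∎)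
    search≤ : 1 + (m * 1 + m * 1) + m * (bitsFor h + (w + w)) ≤ treeDepth
    search≤ = +-monoʳ-≤ (1 + (m * 1 + m * 1)) (*-monoʳ-≤ m (+-monoˡ-≤ (w + w) h≤))
    encode≤ : 1 + (m * 1 + m * 1) + m * bitsFor h ≤ treeDepth
    encode≤ = ≤-trans (+-monoʳ-≤ (1 + (m * 1 + m * 1)) (*-monoʳ-≤ m (m≤m+n _ (w + w)))) search≤
    decode-shape : ∀ m w → m * (w + w + (1 + 1)) + 1 ≡ 1 + (m * 1 + m * 1) + m * (w + w)
    decode-shape = solve-∀
    decode≤ : m * (w + w + (1 + 1)) + 1 ≤ treeDepth
    decode≤ = ≤-trans (≤-reflexive (decode-shape m w))
      (+-monoʳ-≤ (1 + (m * 1 + m * 1)) (*-monoʳ-≤ m (m≤m+n (w + w) (w + w))))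
    E : ℕ
    E = w + (w * m + w * m)
    2M≤2^E : 2 * M ≤ 2 ^ E
    2M≤2^E = begin
      2 * M                                 ≤⟨ fits ⟩
      n * (n ^ m * n ^ m)                   ≤⟨ *-mono-≤ n≤ (*-mono-≤ (^-monoˡ-≤ m n≤) (^-monoˡ-≤ m n≤)) ⟩
      2 ^ w * ((2 ^ w) ^ m * (2 ^ w) ^ m)   ≡⟨ cong (λ t → 2 ^ w * (t * t)) (^-*-assoc 2 w m) ⟩
      2 ^ w * (2 ^ (w * m) * 2 ^ (w * m))   ≡⟨ cong (2 ^ w *_) (^-distribˡ-+-* 2 (w * m) (w * m)) ⟨
      2 ^ w * 2 ^ (w * m + w * m)           ≡⟨ ^-distribˡ-+-* 2 w (w * m + w * m) ⟨
      2 ^ E                                 ∎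
      where
      n≤ : n ≤ 2 ^ w
      n≤ = n≤2^⌈log₂n⌉ n
    -- The bound itself is `(8 m + 2) L + (10 m + 4)`. The slack `(2 m + 2) L` raises the
    -- coefficient of `L` to the constant term, so that one `K` serves for both.
    collect : ∀ m L → let w = 1 + L ; E = w + (w * m + w * m) in
              1 + (E + E) + (1 + (m * 1 + m * 1) + m * (w + w + (w + w))) + (2 * m + 2) * L
              ≡ (10 * m + 4) * (L * 1) + (10 * m + 4)
    collect = solve-∀
    total≤ : ⌈log₂ inputLength (LossyCode M) ⌉ + treeDepth ≤ (10 * m + 4) * (⌈log₂ N ⌉ ^ 1) + (10 * m + 4)
    total≤ = begin
      ⌈log₂ inputLength (LossyCode M) ⌉ + treeDepth  ≤⟨ +-monoˡ-≤ treeDepth (log-inputLength-LossyCode M E 2M≤2^E) ⟩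
      bound w                                        ≤⟨ m≤m+n (bound w) ((2 * m + 2) * ⌈log₂ N ⌉) ⟩
      bound w + (2 * m + 2) * ⌈log₂ N ⌉              ≡⟨ cong (λ v → bound v + (2 * m + 2) * ⌈log₂ N ⌉) (⌈log₂2*n⌉≡1+⌈log₂n⌉ N) ⟩
      bound (1 + ⌈log₂ N ⌉) + (2 * m + 2) * ⌈log₂ N ⌉ ≡⟨ collect m ⌈log₂ N ⌉ ⟩
      (10 * m + 4) * (⌈log₂ N ⌉ ^ 1) + (10 * m + 4)  ∎
      where
      bound : ℕ → ℕ
      bound w = let E = w + (w * m + w * m) in
                1 + (E + E) + (1 + (m * 1 + m * 1) + m * (w + w + (w + w)))

positiveNumerator : ∀ c → 0ℚ < c → ∃ λ p → ↥ c ≡ + suc p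
positiveNumerator c 0<c with c | ℚ.positive 0<c
... | mkℚ (+ suc p) _ _ | _ = p , refl
... | mkℚ (+ 0)     _ _ | ()
... | mkℚ -[1+ _ ]  _ _ | ()

numerator<2*denominator : ∀ c {p} → ↥ c ≡ + p → c < + 2 / 1 → p ℕ.< 2 * ↧ₙ c
numerator<2*denominator c@record{} {p} refl c<2 = ℤ.drop‿+<+ (subst₂ ℤ._<_ (ℤ.*-identityʳ (+ p)) (sym (ℤ.pos-* 2 (↧ₙ c))) (ℚ.drop-*<* c<2))

dual-AMGM→lossyCode : ∀ c N m {p} → ↥ c ≡ + p → p ℕ.< 2 * ↧ₙ c → 4 * suc m * p ^ m ≤ suc p ^ m → 1 ≤ N →
  Σ ℕ λ M → 1 ≤ M × Σ (DTReduction (DualAMGMLC c N) (LossyCode M)) λ R →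
  ComplexityAtMost R ((10 * m + 4) * (⌈log₂ N ⌉ ^ 1) + (10 * m + 4))
dual-AMGM→lossyCode c N m {p} ↥c≡p p<2q grows 1≤N with Hsize c N ≟ 0
dual-AMGM→lossyCode c (suc N) m _ _ _ _ | yes h≡0 =
  1 , ≤-refl , trivialReduction (no-input c (suc N) zero h≡0) (zero , zero) ,
  -- `LossyCode 1` has input length 1, whose logarithm is 0.
  0 , (λ _ → z≤n) , (λ _ → z≤n) , z≤n
dual-AMGM→lossyCode c N m {p} ↥c≡p p<2q grows 1≤N | no h≢0 =
  M , >-nonZero⁻¹ M , dualReduction fits , dualComplexity c N m fits (≤[2N]² {N = N} hq≤ p<2q)
  where
  instance
    N≢0 : NonZero N
    N≢0 = >-nonZero 1≤N
    h≢0′ : NonZero (Hsize c N)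
    h≢0′ = ≢-nonZero h≢0
  open DualToLossy c N m
  hq≤ : h * ↧ₙ c ≤ p * (N * N)
  hq≤ = Hsize-≤ c N ↥c≡p
  fits : 2 * M ≤ n * (n ^ m * n ^ m)
  fits = codes-fit {N = N} {m} hq≤ p<2q grows

theorem6p4 : (c : ℚ) → 0ℚ < c → c < + 2 / 1 →
    ∃ λ (k : ℕ) → ∃ λ (K : ℕ) → ∀ (N : ℕ) → 1 ≤ N →
    Σ ℕ λ M → 1 ≤ M × Σ (DTReduction (DualAMGMLC c N) (LossyCode M)) λ R →
    ComplexityAtMost R (K * (⌈log₂ N ⌉ ^ k) + K)
theorem6p4 c 0<c c<2 with p-1 , ↥c≡p ← positiveNumerator c 0<c =
  -- The block length depends only on the numerator of `c`, so it is constant in `N` and the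
  -- complexity is linear in `⌈log₂ N ⌉`; hence the exponent 1.
  1 , 10 * blockLength (suc p-1) + 4 , λ N →
    dual-AMGM→lossyCode c N (blockLength (suc p-1)) ↥c≡p (numerator<2*denominator c ↥c≡p c<2)
      (linear≤exponential (suc p-1))
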